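{- For any integer $n>1$, there exist regular graphs $G$ with $\chi(G)=n$ and $\chi_2(G)>n$.
   Context: Graphs are finite and simple; a graph is regular if all its vertices have the same degree. $\chi(G)$ denotes the chromatic number of $G$. A dynamic $l$-coloring of $G$ is a proper vertex coloring of $G$ with colors in $\{1,\ldots,l\}$ such that for every vertex $v$ of degree at least $2$, at least two different colors appear on the neighbors of $v$. The dynamic chromatic number $\chi_2(G)$ is the smallest integer $l$ such that $G$ has a dynamic $l$-coloring. -}

module Defs where

open import Level using (0ℓ)
open import Data.Nat using (ℕ; _≤_)
open import Data.Fin using (Fin)
open import Data.Fin.Subset using (Subset; ∣_∣)
open import Data.Vec using (tabulate)
open import Data.Product using (_×_; ∃; ∃₂)
open import Relation.Nullary using (¬_; does)
open import Relation.Unary using (Pred)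
open import Relation.Binary using (Rel; Symmetric; Decidable)
open import Relation.Binary.PropositionalEquality using (_≡_; _≢_)

record Graph : Set₁ where
  field
    order      : ℕ
    Adj        : Rel (Fin order) 0ℓ
    adj?       : Decidable Adj
    adj-sym    : Symmetric Adj
    adj-irrefl : ∀ v → ¬ Adj v v

  Vertex : Set
  Vertex = Fin order

  neighbours : Vertex → Subset order
  neighbours v = tabulate (λ w → does (adj? v w))

  degree : Vertex → ℕ
  degree v = ∣ neighbours v ∣

  Coloring : ℕ → Set
  Coloring l = Vertex → Fin l

  IsProper : ∀ {l} → Coloring l → Set
  IsProper c = ∀ u v → Adj u v → c u ≢ c v

  IsDynamic : ∀ {l} → Coloring l → Set
  IsDynamic c =
    IsProper c ×
    (∀ v → 2 ≤ degree v → ∃₂ λ u w → Adj v u × Adj v w × c u ≢ c w)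

open Graph public using (Coloring; IsProper; IsDynamic)

IsRegular : Graph → Set
IsRegular G = ∀ u v → degree u ≡ degree v
  where open Graph G

IsLeast : Pred ℕ 0ℓ → ℕ → Set
IsLeast P k = P k × (∀ l → P l → k ≤ l)

-- Chromatic numbers are given by their graphs as relations: each relation
-- holds of at most one number, by antisymmetry of _≤_.
IsChromaticNumber : Graph → ℕ → Set
IsChromaticNumber G = IsLeast (λ l → ∃ λ (c : Coloring G l) → IsProper G c)

IsDynamicChromaticNumber : Graph → ℕ → Set
IsDynamicChromaticNumber G = IsLeast (λ l → ∃ λ (c : Coloring G l) → IsDynamic G c)

{-# OPTIONS --safe #-}
module Submission where

-- Two observations reduce the theorem to a single graph with a "hub".
--
-- Suppose that G has chromatic number n and a vertex, the hub, of degree at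
-- least 2 whose neighbours receive equal colors in every proper n-coloring
-- of G.  Then no proper coloring with at most n colors is dynamic, so the
-- dynamic chromatic number of G (which exists, since giving every vertex its
-- own color is dynamic) exceeds n.
--
-- If in addition the hub has maximum degree Δ, then G can be made regular:
-- take two copies of G and join the two copies of every vertex of degree less
-- than Δ (double).  The new graph is again n-colorable, by shifting the
-- colors of the second copy cyclically; its hub, in the first copy, has the
-- same neighbours as before; and all degrees below Δ have grown by one.  After
-- Δ such steps all degrees equal Δ (regularise).
--
-- A graph with such a hub is a chain of D blocks, each a clique on n vertices
-- with one distinguished vertex, its port, where all vertices of a block other
-- than the port are also adjacent to the port of the next block, and where the
-- hub is adjacent to exactly the ports (module Chain).  In a proper n-coloring
-- each block uses every color, which forces consecutive ports to have equal
-- colors (port-step).  The hub has degree D, and any other vertex has at most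
-- 3n + 1 neighbours, namely the hub and vertices of three blocks, so D = 3n + 1
-- makes the hub a vertex of maximum degree.

open import Data.Bool using (Bool; true; false; _∧_; if_then_else_)
open import Data.Empty using (⊥)
open import Data.Fin using (Fin; zero; suc; toℕ; fromℕ; inject₁; inject≤;
  splitAt; _↑ˡ_; _↑ʳ_; combine; remQuot; finToFun; funToFin)
open import Data.Fin.Induction using (<-weakInduction)
import Data.Fin.Properties as Fin
open import Data.Fin.Subset using (Subset; ∣_∣; _∈_; _-_; ⊤)
open import Data.Fin.Subset.Properties using (∈⊤; ∣⊤∣≡n;
  x∈p⇒∣p-x∣<∣p∣; x∈p∧x≢y⇒x∈p-y)
open import Data.Maybe using (Maybe; just; nothing)
open import Data.Nat using (ℕ; zero; suc; _+_; _*_; _≤_; _<_; _>_; z≤n; s≤s;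
  _≤?_; _<?_)
open import Data.Nat.Induction using (<-rec)
import Data.Nat.Properties as ℕ
open import Data.Product using (_×_; _,_; proj₁; proj₂; ∃; ∃-syntax; ∃₂)
open import Data.Sum using (_⊎_; inj₁; inj₂)
open import Data.Vec using ([]; _∷_; here; there; tabulate)
open import Data.Vec.Properties using (lookup∘tabulate; lookup⇒[]=; []=⇒lookup;
  tabulate-cong)
open import Function using (_∘_; id)
open import Level using (0ℓ)
open import Relation.Binary using (Symmetric; Decidable)
open import Relation.Binary.PropositionalEquality using (_≡_; _≢_; _≗_; refl;
  sym; trans; cong; cong₂; subst; subst₂; ≢-sym)
open import Relation.Nullary using (¬_; Dec; yes; no; does; contradiction)
open import Relation.Nullary.Decidable using (map′; dec-true; dec-false;
  _×-dec_; _⊎-dec_; _→-dec_; ¬?)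
import Relation.Unary as U
open import Defs

-- Cardinalities of subsets

-- The injection need only be defined on the members of p.
∣∣-mono-injection : ∀ {m n} (p : Subset m) (q : Subset n)
  (f : ∀ x → x ∈ p → Fin n) →
  (∀ x x∈p → f x x∈p ∈ q) →
  (∀ x y x∈p y∈p → f x x∈p ≡ f y y∈p → x ≡ y) →
  ∣ p ∣ ≤ ∣ q ∣
∣∣-mono-injection []          q f f∈q inj = z≤n
∣∣-mono-injection (false ∷ p) q f f∈q inj =
  ∣∣-mono-injection p q (λ x → f (suc x) ∘ there) (λ x → f∈q (suc x) ∘ there)
    (λ x y x∈p y∈p → Fin.suc-injective ∘ inj _ _ (there x∈p) (there y∈p))
∣∣-mono-injection (true ∷ p)  q f f∈q inj =
  ℕ.≤-<-trans
    (∣∣-mono-injection p (q - f zero here) (λ x → f (suc x) ∘ there)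
      (λ x x∈p → x∈p∧x≢y⇒x∈p-y (f∈q (suc x) (there x∈p))
        (Fin.0≢1+n ∘ sym ∘ inj _ _ (there x∈p) here))
      (λ x y x∈p y∈p → Fin.suc-injective ∘ inj _ _ (there x∈p) (there y∈p)))
    (x∈p⇒∣p-x∣<∣p∣ (f∈q zero here))

∣tabulate∣-+ : ∀ m {n} (f : Fin (m + n) → Bool) →
  ∣ tabulate f ∣ ≡ ∣ tabulate (f ∘ (_↑ˡ n)) ∣ + ∣ tabulate (f ∘ (m ↑ʳ_)) ∣
∣tabulate∣-+ zero    f = refl
∣tabulate∣-+ (suc m) f with f zero
... | true  = cong suc (∣tabulate∣-+ m (f ∘ suc))
... | false = ∣tabulate∣-+ m (f ∘ suc)

∣tabulate-false∣ : ∀ n → ∣ tabulate {n = n} (λ _ → false) ∣ ≡ 0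
∣tabulate-false∣ zero    = refl
∣tabulate-false∣ (suc n) = ∣tabulate-false∣ n

∣tabulate-≟∧∣ : ∀ {n} (u : Fin n) b →
  ∣ tabulate (λ w → does (u Fin.≟ w) ∧ b) ∣ ≡ (if b then 1 else 0)
∣tabulate-≟∧∣ {suc n} zero    true  = cong suc (∣tabulate-false∣ n)
∣tabulate-≟∧∣ {suc n} zero    false = ∣tabulate-false∣ n
∣tabulate-≟∧∣ {suc n} (suc u) b     = ∣tabulate-≟∧∣ u b

module _ (G : Graph) where
  open Graph G using (Adj; adj?; neighbours)

  ∈-neighbours⁺ : ∀ {v w} → Adj v w → w ∈ neighbours v
  ∈-neighbours⁺ {v} {w} vw =
    lookup⇒[]= w _ (trans (lookup∘tabulate _ w) (dec-true (adj? v w) vw))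

  ∈-neighbours⁻ : ∀ {v w} → w ∈ neighbours v → Adj v w
  ∈-neighbours⁻ {v} {w} w∈
    with adj? v w | trans (sym (lookup∘tabulate (does ∘ adj? v) w)) ([]=⇒lookup w∈)
  ... | yes vw | _  = vw
  ... | no _   | ()

-- Existence of the dynamic chromatic number

least : ∀ {P : U.Pred ℕ 0ℓ} → U.Decidable P → ∀ l → P l → ∃ (IsLeast P)
least {P} P? = <-rec _ search
  where
  search : ∀ l → (∀ {m} → m < l → P m → ∃ (IsLeast P)) → P l → ∃ (IsLeast P)
  search l rec pl with ℕ.anyUpTo? P? l
  ... | yes (m , m<l , pm) = rec m<l pm
  ... | no  ¬smaller       =
    l , pl , λ m pm → ℕ.≮⇒≥ (λ m<l → ¬smaller (m , m<l , pm))

-- Without function extensionality the search over all functions needs the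
-- predicate to respect pointwise equality.
anyFunction? : ∀ {m n} {P : U.Pred (Fin m → Fin n) 0ℓ} →
  (∀ {f g} → f ≗ g → P f → P g) → U.Decidable P → Dec (∃ P)
anyFunction? resp P? =
  map′ (λ (i , p) → finToFun i , p)
       (λ (f , p) → funToFin f , resp (sym ∘ Fin.finToFun-funToFin f) p)
       (Fin.any? (P? ∘ finToFun))

module _ (G : Graph) where
  open Graph G using (Adj; adj?; degree; order)

  isDynamic-resp-≗ : ∀ {l} {c d : Coloring G l} → c ≗ d →
    IsDynamic G c → IsDynamic G d
  isDynamic-resp-≗ c≗d (proper , dyn) =
    (λ u v uv → subst₂ _≢_ (c≗d u) (c≗d v) (proper u v uv)) ,
    λ v 2≤ → let u , w , vu , vw , cu≢cw = dyn v 2≤ in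
      u , w , vu , vw , subst₂ _≢_ (c≗d u) (c≗d w) cu≢cw

  isDynamic? : ∀ {l} → U.Decidable (IsDynamic G {l})
  isDynamic? c =
    Fin.all? (λ u → Fin.all? λ v → adj? u v →-dec ¬? (c u Fin.≟ c v))
    ×-dec
    Fin.all? (λ v → (2 ≤? degree v) →-dec
      Fin.any? λ u → Fin.any? λ w →
        adj? v u ×-dec adj? v w ×-dec ¬? (c u Fin.≟ c w))

  twoNeighbours : ∀ v → 2 ≤ degree v → ∃₂ λ u w → Adj v u × Adj v w × u ≢ w
  twoNeighbours v 2≤
    with Fin.any? (λ u → Fin.any? (λ w →
           adj? v u ×-dec adj? v w ×-dec ¬? (u Fin.≟ w)))
  ... | yes found = found
  ... | no  ¬two  = contradiction (ℕ.≤-trans 2≤ degree≤1) λ { (s≤s ()) }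
    where
    -- Otherwise the constant map to a one-element set is injective on the
    -- neighbours of v.
    degree≤1 : degree v ≤ 1
    degree≤1 = ∣∣-mono-injection _ (⊤ {1}) (λ _ _ → zero) (λ _ _ → ∈⊤) same
      where
      same : ∀ x y → x ∈ _ → y ∈ _ → zero ≡ zero → x ≡ y
      same x y x∈ y∈ _ with x Fin.≟ y
      ... | yes x≡y = x≡y
      ... | no  x≢y = contradiction
        (x , y , ∈-neighbours⁻ G x∈ , ∈-neighbours⁻ G y∈ , x≢y) ¬two

  identity-isDynamic : IsDynamic G id
  identity-isDynamic =
    (λ u v uv u≡v → Graph.adj-irrefl G v (subst (λ x → Adj x v) u≡v uv)) ,
    twoNeighbours

  dynamicChromaticNumber : ∃ (IsDynamicChromaticNumber G)
  dynamicChromaticNumber =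
    least (λ l → anyFunction? isDynamic-resp-≗ isDynamic?) order
      (id , identity-isDynamic)

-- Graphs with a hub

-- G has chromatic number n (clauses coloring, proper, n≤colors), maximum
-- degree Δ, and a vertex of degree Δ whose neighbourhood is monochromatic in
-- every proper n-coloring.
record Hub (n Δ : ℕ) (G : Graph) : Set where
  open Graph G using (Vertex; Adj; degree)
  field
    coloring   : Coloring G n
    proper     : IsProper G coloring
    n≤colors   : ∀ l (c : Coloring G l) → IsProper G c → n ≤ l
    degree≤    : ∀ v → degree v ≤ Δ
    hub        : Vertex
    hub-degree : degree hub ≡ Δ
    hub-mono   : ∀ (c : Coloring G n) → IsProper G c →
                 ∀ {u w} → Adj hub u → Adj hub w → c u ≡ c w

module _ {n Δ : ℕ} {G : Graph} (H : Hub n Δ G) where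
  open Hub H

  hub⇒chromatic : IsChromaticNumber G n
  hub⇒chromatic = (coloring , proper) , λ l (c , c-proper) → n≤colors l c c-proper

  hub⇒dynamic> : 2 ≤ Δ → ∀ l (c : Coloring G l) → IsDynamic G c → n < l
  hub⇒dynamic> 2≤Δ l c (c-proper , dyn) = ℕ.≰⇒> λ l≤n →
    let u , w , vu , vw , cu≢cw = dyn hub (subst (2 ≤_) (sym hub-degree) 2≤Δ)
        inj = λ {i} {j} → Fin.inject≤-injective {n = n} l≤n l≤n i j
    in cu≢cw (inj (hub-mono (λ v → inject≤ (c v) l≤n)
                 (λ x y xy → c-proper x y xy ∘ inj) vu vw))

-- A cyclic shift of the colors

shift : ∀ {n} → Fin n → Fin n
shift {suc n} zero    = fromℕ n
shift {suc n} (suc i) = inject₁ i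

shift-injective : ∀ {n} {i j : Fin n} → shift i ≡ shift j → i ≡ j
shift-injective {i = zero}  {zero}  eq = refl
shift-injective {i = zero}  {suc j} eq = contradiction eq Fin.fromℕ≢inject₁
shift-injective {i = suc i} {zero}  eq = contradiction (sym eq) Fin.fromℕ≢inject₁
shift-injective {i = suc i} {suc j} eq = cong suc (Fin.inject₁-injective eq)

shift-≢ : ∀ {n} → 2 ≤ n → (i : Fin n) → i ≢ shift i
shift-≢ {suc (suc n)} _ zero    = Fin.0≢1+n
shift-≢               _ (suc i) eq =
  ℕ.1+n≢n (trans (cong toℕ eq) (Fin.toℕ-inject₁ i))
shift-≢ {suc zero} (s≤s ()) zero

-- Doubling a graph

module Doubling (Δ : ℕ) (G : Graph) where
  open Graph G using (order; Vertex; Adj; adj?; adj-sym; adj-irrefl; degree)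

  -- The two copies of G are the two summands.
  Adj₂ : Vertex ⊎ Vertex → Vertex ⊎ Vertex → Set
  Adj₂ (inj₁ u) (inj₁ w) = Adj u w
  Adj₂ (inj₁ u) (inj₂ w) = u ≡ w × degree u < Δ
  Adj₂ (inj₂ u) (inj₁ w) = u ≡ w × degree u < Δ
  Adj₂ (inj₂ u) (inj₂ w) = Adj u w

  adj₂? : Decidable Adj₂
  adj₂? (inj₁ u) (inj₁ w) = adj? u w
  adj₂? (inj₁ u) (inj₂ w) = (u Fin.≟ w) ×-dec (degree u <? Δ)
  adj₂? (inj₂ u) (inj₁ w) = (u Fin.≟ w) ×-dec (degree u <? Δ)
  adj₂? (inj₂ u) (inj₂ w) = adj? u w

  adj₂-sym : Symmetric Adj₂
  adj₂-sym {inj₁ u} {inj₁ w} a          = adj-sym a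
  adj₂-sym {inj₁ u} {inj₂ w} (refl , d) = refl , d
  adj₂-sym {inj₂ u} {inj₁ w} (refl , d) = refl , d
  adj₂-sym {inj₂ u} {inj₂ w} a          = adj-sym a

  adj₂-irrefl : ∀ s → ¬ Adj₂ s s
  adj₂-irrefl (inj₁ u) = adj-irrefl u
  adj₂-irrefl (inj₂ u) = adj-irrefl u

  double : Graph
  double = record
    { order      = order + order
    ; Adj        = λ x y → Adj₂ (splitAt order x) (splitAt order y)
    ; adj?       = λ x y → adj₂? (splitAt order x) (splitAt order y)
    ; adj-sym    = λ {x} {y} → adj₂-sym {splitAt order x} {splitAt order y}
    ; adj-irrefl = λ x → adj₂-irrefl (splitAt order x)
    }

  -- The vertex of G of which a vertex of the doubled graph is a copy.
  base : Vertex ⊎ Vertex → Vertex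
  base (inj₁ u) = u
  base (inj₂ u) = u

  -- The degree of either copy of a vertex of degree d.
  raised : ℕ → ℕ
  raised d = d + (if does (d <? Δ) then 1 else 0)

  degree₂ : ∀ s →
    ∣ tabulate (does ∘ adj₂? s ∘ inj₁) ∣ + ∣ tabulate (does ∘ adj₂? s ∘ inj₂) ∣
      ≡ raised (degree (base s))
  degree₂ (inj₁ u) = cong (degree u +_) (∣tabulate-≟∧∣ u _)
  degree₂ (inj₂ u) =
    trans (ℕ.+-comm _ (degree u)) (cong (degree u +_) (∣tabulate-≟∧∣ u _))

  degree-double : ∀ x →
    Graph.degree double x ≡ raised (degree (base (splitAt order x)))
  degree-double x =
    trans (∣tabulate∣-+ order _)
    (trans
      (cong₂ _+_
        (cong ∣_∣ (tabulate-cong λ w →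
          cong (does ∘ adj₂? (splitAt order x)) (Fin.splitAt-↑ˡ order w order)))
        (cong ∣_∣ (tabulate-cong λ w →
          cong (does ∘ adj₂? (splitAt order x)) (Fin.splitAt-↑ʳ order order w))))
      (degree₂ (splitAt order x)))

  raised-< : ∀ {d} → d < Δ → raised d ≡ suc d
  raised-< {d} d<Δ = trans
    (cong (λ b → d + (if b then 1 else 0)) (dec-true (d <? Δ) d<Δ)) (ℕ.+-comm d 1)

  raised-≮ : ∀ {d} → ¬ d < Δ → raised d ≡ d
  raised-≮ {d} d≮Δ = trans
    (cong (λ b → d + (if b then 1 else 0)) (dec-false (d <? Δ) d≮Δ)) (ℕ.+-identityʳ d)

  raised≤ : ∀ {d} → d ≤ Δ → raised d ≤ Δ
  raised≤ {d} d≤Δ with d <? Δ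
  ... | yes d<Δ = subst (_≤ Δ) (sym (raised-< d<Δ)) d<Δ
  ... | no  d≮Δ = subst (_≤ Δ) (sym (raised-≮ d≮Δ)) d≤Δ

  ≤+raised : ∀ {j d} → Δ ≤ suc j + d → Δ ≤ j + raised d
  ≤+raised {j} {d} Δ≤ with d <? Δ
  ... | yes d<Δ = subst (Δ ≤_)
    (trans (sym (ℕ.+-suc j d)) (cong (j +_) (sym (raised-< d<Δ)))) Δ≤
  ... | no  d≮Δ = subst (λ r → Δ ≤ j + r) (sym (raised-≮ d≮Δ))
    (ℕ.≤-trans (ℕ.≮⇒≥ d≮Δ) (ℕ.m≤n+m d j))

  left : Vertex → Graph.Vertex double
  left u = u ↑ˡ order

  splitAt-left : ∀ u → splitAt order (left u) ≡ inj₁ u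
  splitAt-left u = Fin.splitAt-↑ˡ order u order

  restrict-proper : ∀ {l} (c : Coloring double l) →
    IsProper double c → IsProper G (c ∘ left)
  restrict-proper c c-proper u w uw = c-proper (left u) (left w)
    (subst₂ Adj₂ (sym (splitAt-left u)) (sym (splitAt-left w)) uw)

  hub-double : ∀ {n} → 2 ≤ n → Hub n Δ G → Hub n Δ double
  hub-double {n} 2≤n H = record
    { coloring   = color ∘ splitAt order
    ; proper     = λ x y → color-proper (splitAt order x) (splitAt order y)
    ; n≤colors   = λ l c → n≤colors l (c ∘ left) ∘ restrict-proper c
    ; degree≤    = λ x → subst (_≤ Δ) (sym (degree-double x)) (raised≤ (degree≤ _))
    ; hub        = left hub
    ; hub-degree = trans (degree-double (left hub))
        (trans (cong (raised ∘ degree ∘ base) (splitAt-left hub))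
          (trans (cong raised hub-degree) (raised-≮ (ℕ.<-irrefl refl))))
    ; hub-mono   = mono
    }
    where
    open Hub H

    color : Vertex ⊎ Vertex → Fin n
    color (inj₁ u) = coloring u
    color (inj₂ u) = shift (coloring u)

    color-proper : ∀ s t → Adj₂ s t → color s ≢ color t
    color-proper (inj₁ u) (inj₁ w) uw         = proper u w uw
    color-proper (inj₁ u) (inj₂ w) (refl , _) = shift-≢ 2≤n (coloring u)
    color-proper (inj₂ u) (inj₁ w) (refl , _) = ≢-sym (shift-≢ 2≤n (coloring u))
    color-proper (inj₂ u) (inj₂ w) uw         = proper u w uw ∘ shift-injective

    hub-neighbour : ∀ {x} → Graph.Adj double (left hub) x →
      ∃ λ u → Adj hub u × left u ≡ x
    hub-neighbour {x} a
      with splitAt order x in eq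
         | subst (λ s → Adj₂ s (splitAt order x)) (splitAt-left hub) a
    ... | inj₁ u | hu        = u , hu , Fin.splitAt⁻¹-↑ˡ eq
    ... | inj₂ u | (_ , d<Δ) = contradiction hub-degree (ℕ.<⇒≢ d<Δ)

    mono : ∀ (c : Coloring double n) → IsProper double c →
      ∀ {x y} → Graph.Adj double (left hub) x → Graph.Adj double (left hub) y →
      c x ≡ c y
    mono c c-proper hx hy with hub-neighbour hx | hub-neighbour hy
    ... | u , hu , refl | w , hw , refl =
      hub-mono (c ∘ left) (restrict-proper c c-proper) hu hw

-- Induction on a bound j for the deficiency Δ - degree v of every vertex v.
regularise : ∀ {n Δ} → 2 ≤ n → ∀ j G → Hub n Δ G →
  (∀ v → Δ ≤ j + Graph.degree G v) → ∃[ G′ ] (Hub n Δ G′ × IsRegular G′)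
regularise 2≤n zero G H Δ≤ =
  G , H , λ u v → trans (degree≡ u) (sym (degree≡ v))
  where
  degree≡ : ∀ v → Graph.degree G v ≡ _
  degree≡ v = ℕ.≤-antisym (Hub.degree≤ H v) (Δ≤ v)
regularise {Δ = Δ} 2≤n (suc j) G H Δ≤ =
  regularise 2≤n j double (hub-double 2≤n H)
    (λ x → subst (λ d → Δ ≤ j + d) (sym (degree-double x)) (≤+raised {j} (Δ≤ _)))
  where open Doubling Δ G

-- The chain of cliques

-- An injective self-map f of a finite set is onto, so a y that is not one of
-- the values at the positive arguments is the value at zero.
missed-color : ∀ {n} (f : Fin (suc n) → Fin (suc n)) →
  (∀ a b → a ≢ b → f a ≢ f b) → (y : Fin (suc n)) →
  (∀ a → f (suc a) ≢ y) → f zero ≡ y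
missed-color {n} f f-inj y missed = pigeon
  where
  g : Fin (suc (suc n)) → Fin (suc n)
  g zero    = y
  g (suc a) = f a

  pigeon : f zero ≡ y
  pigeon with Fin.pigeonhole (ℕ.n<1+n (suc n)) g
  ... | zero  , suc zero    , _ , eq = sym eq
  ... | zero  , suc (suc b) , _ , eq = contradiction (sym eq) (missed b)
  ... | suc a , suc b , a<b , eq =
    contradiction eq (f-inj a b (Fin.<⇒≢ (ℕ.≤-pred a<b)))

-- With m = n - 2 the cliques have n vertices.  There are D = 3n + 1 of them.
module Chain (m : ℕ) where

  n D : ℕ
  n = suc (suc m)
  D = suc (3 * n)

  -- The hub is nothing, and just (i , a) is vertex a of the i-th clique, whose
  -- port is just (i , zero).
  Site : Set
  Site = Maybe (Fin D × Fin n)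

  -- Next u v: u is not a port, and v is the port of the following clique.
  Next : Fin D × Fin n → Fin D × Fin n → Set
  Next (i , a) (j , b) = suc (toℕ i) ≡ toℕ j × a ≢ zero × b ≡ zero

  Link : Site → Site → Set
  Link nothing        nothing        = ⊥
  Link nothing        (just (j , b)) = b ≡ zero
  Link (just (i , a)) nothing        = a ≡ zero
  Link (just (i , a)) (just (j , b)) =
    (i ≡ j × a ≢ b) ⊎ Next (i , a) (j , b) ⊎ Next (j , b) (i , a)

  next? : Decidable Next
  next? (i , a) (j , b) =
    (suc (toℕ i) ℕ.≟ toℕ j) ×-dec ¬? (a Fin.≟ zero) ×-dec (b Fin.≟ zero)

  link? : Decidable Link
  link? nothing        nothing        = no λ ()
  link? nothing        (just (j , b)) = b Fin.≟ zero
  link? (just (i , a)) nothing        = a Fin.≟ zero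
  link? (just (i , a)) (just (j , b)) =
    ((i Fin.≟ j) ×-dec ¬? (a Fin.≟ b))
    ⊎-dec next? (i , a) (j , b) ⊎-dec next? (j , b) (i , a)

  link-sym : Symmetric Link
  link-sym {nothing} {just _}  e = e
  link-sym {just _}  {nothing} e = e
  link-sym {just _}  {just _}  (inj₁ (refl , a≢b)) = inj₁ (refl , ≢-sym a≢b)
  link-sym {just _}  {just _}  (inj₂ (inj₁ e))     = inj₂ (inj₂ e)
  link-sym {just _}  {just _}  (inj₂ (inj₂ e))     = inj₂ (inj₁ e)

  link-irrefl : ∀ s → ¬ Link s s
  link-irrefl (just _) (inj₁ (_ , a≢a))           = a≢a refl
  link-irrefl (just _) (inj₂ (inj₁ (1+i≡i , _)))  = ℕ.1+n≢n 1+i≡i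
  link-irrefl (just _) (inj₂ (inj₂ (1+i≡i , _)))  = ℕ.1+n≢n 1+i≡i

  encode : Site → Fin (suc (D * n))
  encode nothing        = zero
  encode (just (i , a)) = suc (combine i a)

  decode : Fin (suc (D * n)) → Site
  decode zero    = nothing
  decode (suc k) = just (remQuot {D} n k)

  decode-encode : ∀ s → decode (encode s) ≡ s
  decode-encode nothing        = refl
  decode-encode (just (i , a)) = cong just (Fin.remQuot-combine i a)

  encode-decode : ∀ x → encode (decode x) ≡ x
  encode-decode zero    = refl
  encode-decode (suc k) = cong suc (Fin.combine-remQuot {D} n k)

  decode-injective : ∀ {x y} → decode x ≡ decode y → x ≡ y
  decode-injective {x} {y} eq =
    trans (sym (encode-decode x)) (trans (cong encode eq) (encode-decode y))

  chain : Graph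
  chain = record
    { order      = suc (D * n)
    ; Adj        = λ x y → Link (decode x) (decode y)
    ; adj?       = λ x y → link? (decode x) (decode y)
    ; adj-sym    = λ {x} {y} → link-sym {decode x} {decode y}
    ; adj-irrefl = λ x → link-irrefl (decode x)
    }

  open Graph chain using (degree; neighbours)

  adj-encode : ∀ {s t} → Link s t → Graph.Adj chain (encode s) (encode t)
  adj-encode {s} {t} = subst₂ Link (sym (decode-encode s)) (sym (decode-encode t))

  -- Degrees in the chain

  -- A link from a given clique vertex to another is determined by its kind and by the
  -- position of its other end within a clique.
  kind : ∀ {u v} → Link (just u) (just v) → Fin 3
  kind (inj₁ _)        = zero
  kind (inj₂ (inj₁ _)) = suc zero
  kind (inj₂ (inj₂ _)) = suc (suc zero)

  kind-determines : ∀ {u j b k c}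
    (e : Link (just u) (just (j , b))) (e′ : Link (just u) (just (k , c))) →
    kind e ≡ kind e′ → j ≡ k
  kind-determines (inj₁ (i≡j , _)) (inj₁ (i≡k , _)) _ = trans (sym i≡j) i≡k
  kind-determines (inj₂ (inj₁ (1+i≡j , _))) (inj₂ (inj₁ (1+i≡k , _))) _ =
    Fin.toℕ-injective (trans (sym 1+i≡j) 1+i≡k)
  kind-determines (inj₂ (inj₂ (1+j≡i , _))) (inj₂ (inj₂ (1+k≡i , _))) _ =
    Fin.toℕ-injective (ℕ.suc-injective (trans 1+j≡i (sym 1+k≡i)))
  kind-determines (inj₁ _)        (inj₂ (inj₁ _)) ()
  kind-determines (inj₁ _)        (inj₂ (inj₂ _)) ()
  kind-determines (inj₂ (inj₁ _)) (inj₁ _)        ()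
  kind-determines (inj₂ (inj₁ _)) (inj₂ (inj₂ _)) ()
  kind-determines (inj₂ (inj₂ _)) (inj₁ _)        ()
  kind-determines (inj₂ (inj₂ _)) (inj₂ (inj₁ _)) ()

  -- A numbering of the neighbours of v; zero is reserved for the hub.
  slot : ∀ v t → Link (just v) t → Fin D
  slot v nothing        _ = zero
  slot v (just (j , b)) e = suc (combine (kind e) b)

  slot-injective : ∀ v s t (e : Link (just v) s) (e′ : Link (just v) t) →
    slot v s e ≡ slot v t e′ → s ≡ t
  slot-injective v nothing        nothing        _ _  _ = refl
  slot-injective v (just (j , b)) (just (k , c)) e e′ eq =
    let kinds , positions =
          Fin.combine-injective (kind e) b (kind e′) c (Fin.suc-injective eq)
    in cong₂ (λ i a → just (i , a)) (kind-determines e e′ kinds) positions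

  clique-degree≤ : ∀ k → degree (suc k) ≤ D
  clique-degree≤ k = subst (degree (suc k) ≤_) (∣⊤∣≡n D)
    (∣∣-mono-injection (neighbours (suc k)) ⊤
      (λ y y∈ → slot v (decode y) (∈-neighbours⁻ chain {suc k} y∈)) (λ _ _ → ∈⊤)
      (λ x y x∈ y∈ → decode-injective ∘ slot-injective v (decode x) (decode y) _ _))
    where v = remQuot {D} n k

  port : Fin D → Site
  port i = just (i , zero)

  hub-neighbour : ∀ t → Link nothing t → ∃ λ i → port i ≡ t
  hub-neighbour (just (i , _)) refl = i , refl

  encode-port-injective : ∀ {i j} → encode (port i) ≡ encode (port j) → i ≡ j
  encode-port-injective {i} {j} eq =
    Fin.combine-injectiveˡ i zero j zero (Fin.suc-injective eq)

  hub-degree≥ : D ≤ degree zero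
  hub-degree≥ = subst (_≤ degree zero) (∣⊤∣≡n D)
    (∣∣-mono-injection ⊤ (neighbours zero) (λ i _ → encode (port i))
      (λ i _ → ∈-neighbours⁺ chain {zero} (adj-encode {nothing} {port i} refl))
      (λ i j _ _ → encode-port-injective))

  hub-degree≤ : degree zero ≤ D
  hub-degree≤ = subst (degree zero ≤_) (∣⊤∣≡n D)
    (∣∣-mono-injection (neighbours zero) ⊤
      (λ y y∈ → proj₁ (index y y∈)) (λ _ _ → ∈⊤)
      (λ x y x∈ y∈ eq → decode-injective
        (trans (sym (proj₂ (index x x∈)))
          (trans (cong port eq) (proj₂ (index y y∈))))))
    where
    index : ∀ y → y ∈ neighbours zero → ∃ λ i → port i ≡ decode y
    index y y∈ = hub-neighbour (decode y) (∈-neighbours⁻ chain {zero} y∈)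

  -- Colorings of the chain

  -- Any color other than that of the ports would do for the hub.
  color : Site → Fin n
  color nothing        = suc zero
  color (just (i , a)) = a

  color-proper : ∀ s t → Link s t → color s ≢ color t
  color-proper nothing  (just _) refl ()
  color-proper (just _) nothing  refl ()
  color-proper (just _) (just _) (inj₁ (_ , a≢b))              = a≢b
  color-proper (just _) (just _) (inj₂ (inj₁ (_ , a≢0 , refl))) = a≢0
  color-proper (just _) (just _) (inj₂ (inj₂ (_ , b≢0 , refl))) = ≢-sym b≢0

  module _ {l : ℕ} (c : Coloring chain l) (c-proper : IsProper chain c) where

    link-≢ : ∀ s t → Link s t → c (encode s) ≢ c (encode t)
    link-≢ s t st = c-proper (encode s) (encode t) (adj-encode {s} {t} st)

    clique-≢ : ∀ i a b → a ≢ b → c (encode (just (i , a))) ≢ c (encode (just (i , b)))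
    clique-≢ i a b a≢b = link-≢ (just (i , a)) (just (i , b)) (inj₁ (refl , a≢b))

  n≤colors : ∀ l (c : Coloring chain l) → IsProper chain c → n ≤ l
  n≤colors l c c-proper = Fin.injective⇒≤ {f = λ a → c (encode (just (zero , a)))} inj
    where
    inj : ∀ {a b} → c (encode (just (zero , a))) ≡ c (encode (just (zero , b))) → a ≡ b
    inj {a} {b} eq with a Fin.≟ b
    ... | yes a≡b = a≡b
    ... | no  a≢b = contradiction eq (clique-≢ c c-proper zero a b a≢b)

  module _ (c : Coloring chain n) (c-proper : IsProper chain c) where

    port-step : ∀ i j → suc (toℕ i) ≡ toℕ j →
      c (encode (port i)) ≡ c (encode (port j))
    port-step i j 1+i≡j =
      missed-color (λ a → c (encode (just (i , a)))) (clique-≢ c c-proper i)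
        (c (encode (port j)))
        (λ a → link-≢ c c-proper (just (i , suc a)) (port j)
          (inj₂ (inj₁ (1+i≡j , (λ ()) , refl))))

    port≡port₀ : ∀ i → c (encode (port i)) ≡ c (encode (port zero))
    port≡port₀ = <-weakInduction (λ i → c (encode (port i)) ≡ c (encode (port zero))) refl
      λ i ih → trans
        (sym (port-step (inject₁ i) (suc i) (cong suc (Fin.toℕ-inject₁ i)))) ih

    hub-neighbour≡port₀ : ∀ u → Graph.Adj chain zero u → c u ≡ c (encode (port zero))
    hub-neighbour≡port₀ u hu with hub-neighbour (decode u) hu
    ... | i , port≡u =
      trans (cong c (trans (sym (encode-decode u)) (cong encode (sym port≡u))))
        (port≡port₀ i)

  chain-hub : Hub n D chain
  chain-hub = record
    { coloring   = color ∘ decode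
    ; proper     = λ x y → color-proper (decode x) (decode y)
    ; n≤colors   = n≤colors
    ; degree≤    = λ { zero → hub-degree≤ ; (suc k) → clique-degree≤ k }
    ; hub        = zero
    ; hub-degree = ℕ.≤-antisym hub-degree≤ hub-degree≥
    ; hub-mono   = λ c c-proper hu hw →
        trans (hub-neighbour≡port₀ c c-proper _ hu)
          (sym (hub-neighbour≡port₀ c c-proper _ hw))
    }

proposition1 : ∀ (n : ℕ) → n > 1 →
    ∃[ G ] (IsRegular G × IsChromaticNumber G n ×
    (∃[ k ] (IsDynamicChromaticNumber G k × k > n)))
proposition1 (suc zero) (s≤s ())
proposition1 (suc (suc m)) n>1 =
  let G , H , regular = regularise n>1 D chain chain-hub (λ v → ℕ.m≤m+n D _)
      k , isDyn@((c , c-dynamic) , _) = dynamicChromaticNumber G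
  in G , regular , hub⇒chromatic H ,
     k , isDyn , hub⇒dynamic> H (s≤s (s≤s z≤n)) k c c-dynamic
  where open Chain m
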